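{- Let $n\ge2$. A vertex of $G_n$ is simplicial if and only if it is a prime power (that is, of the form $p^a$ with $p$ prime and $a\ge1$). The true-twin classes of simplicial vertices of $G_n$ are the sets \[ \{p,p^2,\ldots,p^a\},\qquad a=\max\{j:p^j\le n\}, \] one class for each prime $p\le n$. Consequently, with $\operatorname{Tw}(v)=\{u:N[u]=N[v]\}$ denoting the true-twin class of $v$, \[ \pi(n)=\sum_{\substack{v\in V(G_n)\\ v\text{ simplicial}}}\frac{1}{|\operatorname{Tw}(v)|}. \]
   Context: $G_n$ is the simple graph with vertex set $V(G_n)=\{2,\ldots,n\}$ in which two distinct vertices $x,y$ are adjacent if and only if $\gcd(x,y)>1$. $N(v)$ is the open neighborhood of $v$ and $N[v]=N(v)\cup\{v\}$ its closed neighborhood. A vertex is simplicial if its open neighborhood induces a clique (an empty neighborhood counts as a clique). Two vertices are true twins if their closed neighborhoods are equal. $\pi(n)$ is the number of primes at most $n$. -}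

module Defs where

open import Data.Integer using (+_)
open import Data.List using (List; []; _∷_; filter; foldr; length; upTo)
open import Data.List.Membership.Propositional using (mapWith∈) renaming (_∈_ to _∈ₗ_)
open import Data.List.Membership.Propositional.Properties
  using (∈-filter⁺; ∈-filter⁻; ∈-length; ∈-upTo⁺; ∈-upTo⁻)
import Data.List.Membership.DecPropositional as DecMembership
import Data.List.Relation.Unary.All as All
open import Data.List.Relation.Unary.Any using (here; there)
open import Data.List.Relation.Unary.Unique.Propositional using (Unique)
import Data.List.Relation.Unary.Unique.Propositional.Properties as Unique
open import Data.Nat using (ℕ; suc; _≤_; _<_; _≤?_; _<?_; _^_; NonZero; >-nonZero; s≤s; s≤s⁻¹)
import Data.Nat.Properties as ℕ
open import Data.Nat.GCD using (gcd; gcd-comm)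
open import Data.Nat.Primality using (Prime; prime?)
open import Data.Product using (_×_; _,_; proj₁; proj₂; ∃-syntax)
open import Data.Rational using (ℚ; 0ℚ; _+_; _/_)
open import Data.Sum using (inj₁; inj₂)
open import Function using (id; _∘_)
open import Function.Bundles using (_⇔_; mk⇔)
open import Level using (0ℓ)
open import Relation.Binary using (Rel; DecidableEquality; Symmetric; Irreflexive)
import Relation.Binary.Definitions as Binary
open import Relation.Binary.PropositionalEquality using (_≡_; _≢_; refl; sym; subst)
open import Relation.Nullary using (Dec)
open import Relation.Nullary.Decidable using (map′; ¬?; _×-dec_; _⊎-dec_; _→-dec_)
open import Relation.Unary using (Pred; Decidable; _∈_; _⊆_; _≐_; _∪_; ｛_｝)

-- The vertex set is the set of entries of `vertices`; `_~_` only matters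
-- between vertices.
record FiniteSimpleGraph (A : Set) : Set₁ where
  infix 4 _≟_ _~_ _~?_
  field
    _≟_      : DecidableEquality A
    vertices : List A
    unique   : Unique vertices
    _~_      : Rel A 0ℓ
    ~-sym    : Symmetric _~_
    ~-irrefl : Irreflexive _≡_ _~_
    _~?_     : Binary.Decidable _~_

  V : Pred A 0ℓ
  V v = v ∈ₗ vertices

  N : A → Pred A 0ℓ
  N v u = u ∈ V × v ~ u

  N[_] : A → Pred A 0ℓ
  N[ v ] = N v ∪ ｛ v ｝

  IsClique : Pred A 0ℓ → Set
  IsClique S = ∀ {x y} → x ∈ S → y ∈ S → x ≢ y → x ~ y

  Simplicial : Pred A 0ℓ
  Simplicial v = IsClique (N v)

  Tw : A → Pred A 0ℓ
  Tw v u = u ∈ V × N[ u ] ≐ N[ v ]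

  IsSimplicialTwinClass : Pred A 0ℓ → Set
  IsSimplicialTwinClass S = ∃[ v ] v ∈ V × v ∈ Simplicial × S ≐ Tw v

  open DecMembership _≟_ using () renaming (_∈?_ to _∈ₗ?_)

  N? : ∀ v → Decidable (N v)
  N? v u = (u ∈ₗ? vertices) ×-dec (v ~? u)

  N[_]? : ∀ v → Decidable N[ v ]
  N[ v ]? u = N? v u ⊎-dec (v ≟ u)

  simplicial? : Decidable Simplicial
  simplicial? v = map′
    (λ h x∈N y∈N → All.lookup (All.lookup h (proj₁ x∈N)) (proj₁ y∈N) x∈N y∈N)
    (λ h → All.tabulate λ _ → All.tabulate λ _ → h)
    (All.all? (λ x → All.all? (λ y →
      N? v x →-dec (N? v y →-dec (¬? (x ≟ y) →-dec (x ~? y)))) vertices) vertices)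

  N[]⊆? : ∀ u v → Dec (N[ u ] ⊆ N[ v ])
  N[]⊆? u v = map′
    (λ { h x∈@(inj₁ (x∈V , _)) → All.lookup h (there x∈V) x∈
       ; h x∈@(inj₂ refl)      → All.lookup h (here refl) x∈ })
    (λ h → All.tabulate λ _ → h)
    (All.all? (λ x → N[ u ]? x →-dec N[ v ]? x) (u ∷ vertices))

  Tw? : ∀ v → Decidable (Tw v)
  Tw? v u = (u ∈ₗ? vertices) ×-dec (N[]⊆? u v ×-dec N[]⊆? v u)

  ∣Tw∣ : A → ℕ
  ∣Tw∣ v = length (filter (Tw? v) vertices)

  ∣Tw∣-nonZero : ∀ {v} → v ∈ V → NonZero (∣Tw∣ v)
  ∣Tw∣-nonZero {v} v∈V =
    >-nonZero (∈-length (∈-filter⁺ (Tw? v) v∈V (v∈V , id , id)))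

  simplicialVertices : List A
  simplicialVertices = filter simplicial? vertices

  1/∣Tw∣ : ∀ v → v ∈ V → ℚ
  1/∣Tw∣ v v∈V = _/_ (+ 1) (∣Tw∣ v) {{∣Tw∣-nonZero v∈V}}

  ∑-simplicial-1/∣Tw∣ : ℚ
  ∑-simplicial-1/∣Tw∣ = foldr _+_ 0ℚ
    (mapWith∈ simplicialVertices
      (λ {v} v∈ → 1/∣Tw∣ v (proj₁ (∈-filter⁻ simplicial? v∈))))

G : ℕ → FiniteSimpleGraph ℕ
G n = record
  { _≟_      = ℕ._≟_
  ; vertices = filter (2 ≤?_) (upTo (suc n))
  ; unique   = Unique.filter⁺ (2 ≤?_) (Unique.upTo⁺ (suc n))
  ; _~_      = λ x y → x ≢ y × 1 < gcd x y
  ; ~-sym    = λ {x} {y} (x≢y , 1<g) → x≢y ∘ sym , subst (1 <_) (gcd-comm x y) 1<g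
  ; ~-irrefl = λ x≡y (x≢y , _) → x≢y x≡y
  ; _~?_     = λ x y → ¬? (x ℕ.≟ y) ×-dec (1 <? gcd x y)
  }

module _ (n : ℕ) where
  open FiniteSimpleGraph (G n) using (V)

  ∈V⇔ : ∀ {v} → v ∈ V ⇔ (2 ≤ v × v ≤ n)
  ∈V⇔ = mk⇔
    (λ v∈V → let v∈upTo , 2≤v = ∈-filter⁻ (2 ≤?_) v∈V in 2≤v , s≤s⁻¹ (∈-upTo⁻ v∈upTo))
    (λ (2≤v , v≤n) → ∈-filter⁺ (2 ≤?_) (∈-upTo⁺ (s≤s v≤n)) 2≤v)

IsPrimePower : Pred ℕ 0ℓ
IsPrimePower v = ∃[ p ] ∃[ a ] Prime p × 1 ≤ a × v ≡ p ^ a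

IsMaximum : Pred ℕ 0ℓ → Pred ℕ 0ℓ
IsMaximum P a = a ∈ P × (∀ {j} → j ∈ P → j ≤ a)

-- {p, p², …, pᵃ}
powers : ℕ → ℕ → Pred ℕ 0ℓ
powers p a u = ∃[ j ] 1 ≤ j × j ≤ a × u ≡ p ^ j

π : ℕ → ℕ
π n = length (filter prime? (upTo (suc n)))

{-# OPTIONS --safe #-}
-- For a prime power v = pᵃ the closed neighbourhood N[ v ] consists of the
-- multiples of p, which are pairwise adjacent; conversely, the prime divisors
-- of a vertex v lie in N[ v ] and are pairwise non-adjacent, so a simplicial v
-- has only one. The prime divisors of u also lie in N[ u ], so a twin of pᵃ
-- has no prime divisor but p. The formula for π is a double count: every
-- simplicial vertex is a twin of exactly one prime, and the |Tw(p)| twins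
-- of p contribute 1/|Tw(p)| each.
module Submission where

open import Defs
open import Algebra.Bundles using (CommutativeMonoid)
import Algebra.Properties.CommutativeSemigroup as CommutativeSemigroupProperties
open import Data.Bool using (true; false; if_then_else_)
open import Data.Integer as ℤ using (+_)
import Data.Integer.Properties as ℤ
open import Data.List using (List; []; _∷_; filter; foldr; length; map; upTo)
open import Data.List.Membership.Propositional using () renaming (_∈_ to _∈ₗ_)
open import Data.List.Membership.Propositional.Properties
  using (∈-filter⁺; ∈-filter⁻; ∈-upTo⁺; ∈-upTo⁻; mapWith∈-cong; mapWith∈≗map)
open import Data.List.Properties using (filter-accept; filter-reject; filter-≐)
open import Data.List.Relation.Unary.All as All using (All; []; _∷_)
open import Data.List.Relation.Unary.AllPairs using (_∷_)
open import Data.List.Relation.Unary.Any using (here; there)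
open import Data.List.Relation.Unary.Unique.Propositional using (Unique)
import Data.List.Relation.Unary.Unique.Propositional.Properties as Unique
open import Data.Nat
  using (ℕ; zero; suc; _≤_; _<_; _≤?_; _^_; _*_; NonZero; ≢-nonZero; >-nonZero; z≤n; s≤s; s≤s⁻¹;
         nonTrivial⇒n>1)
open import Data.Nat.Divisibility using (_∣_; ∣⇒≤; ∣1⇒≡1; ∣-refl; ∣-trans; m∣m*n)
open import Data.Nat.GCD using (gcd; gcd[m,n]∣m; gcd[m,n]∣n; gcd-greatest; gcd[m,n]≢0)
open import Data.Nat.ListAction using (product)
open import Data.Nat.ListAction.Properties using (∈⇒∣product)
import Data.Nat.Properties as ℕ
open import Data.Nat.Primality
  using (Prime; prime?; prime⇒irreducible; prime⇒nonTrivial; prime⇒nonZero; euclidsLemma)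
open import Data.Nat.Primality.Factorisation using (PrimeFactorisation; factorise)
open import Data.Product using (_×_; _,_; proj₁; proj₂; ∃-syntax; ∃!)
open import Data.Rational as ℚ using (ℚ; 0ℚ; 1ℚ; _/_; fromℚᵘ)
import Data.Rational.Properties as ℚ
open import Data.Rational.Unnormalised as ℚᵘ using (mkℚᵘ; *≡*)
import Data.Rational.Unnormalised.Properties as ℚᵘ
open import Data.Sum using (inj₁; inj₂)
open import Function using (_∘_)
open import Function.Bundles using (_⇔_; mk⇔; Equivalence)
open import Level using (0ℓ)
open import Relation.Binary.PropositionalEquality
  using (_≡_; _≢_; refl; sym; trans; cong; cong₂; subst; module ≡-Reasoning)
open import Relation.Nullary using (yes; no; does; contradiction)
open import Relation.Nullary.Decidable using (dec-true; dec-false)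
open import Relation.Unary using (Pred; Decidable; _∈_; _⊆_; _≐_)
open import Relation.Unary.Properties using (≐-sym; ≐-trans)
open CommutativeSemigroupProperties
  (CommutativeMonoid.commutativeSemigroup ℚ.+-0-commutativeMonoid) using (interchange)

private variable
  A B : Set
  a d k m n p q u v x y : ℕ

-- Primes and prime powers

prime⇒1< : Prime p → 1 < p
prime⇒1< {p} pp = nonTrivial⇒n>1 p {{prime⇒nonTrivial pp}}

prime∣prime⇒≡ : Prime p → Prime q → q ∣ p → q ≡ p
prime∣prime⇒≡ pp pq q∣p with prime⇒irreducible pp q∣p
... | inj₁ q≡1 = contradiction (sym q≡1) (ℕ.<⇒≢ (prime⇒1< pq))
... | inj₂ q≡p = q≡p

prime∣prime^⇒≡ : ∀ k → Prime p → Prime q → q ∣ p ^ k → q ≡ p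
prime∣prime^⇒≡ zero pp pq q∣1 =
  contradiction (sym (∣1⇒≡1 q∣1)) (ℕ.<⇒≢ (prime⇒1< pq))
prime∣prime^⇒≡ {p} (suc k) pp pq q∣p^ with euclidsLemma p (p ^ k) pq q∣p^
... | inj₁ q∣p  = prime∣prime⇒≡ pp pq q∣p
... | inj₂ q∣pᵏ = prime∣prime^⇒≡ k pp pq q∣pᵏ

p∣p^k : 1 ≤ k → p ∣ p ^ k
p∣p^k {suc k} {p} _ = m∣m*n (p ^ k)

∃prime∣ : 1 < n → ∃[ p ] Prime p × p ∣ n
∃prime∣ {n} 1<n with factorise n {{>-nonZero (ℕ.<⇒≤ 1<n)}}
... | record { factors = [] ; isFactorisation = refl } = contradiction 1<n (ℕ.<-irrefl refl)
... | record { factors = p ∷ ps ; isFactorisation = refl ; factorsPrime = pp ∷ _ } =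
  p , pp , m∣m*n (product ps)

product-≡ : ∀ {ps} → All (_≡ p) ps → product ps ≡ p ^ length ps
product-≡ []            = refl
product-≡ {p} (refl ∷ ps≡p) = cong (p *_) (product-≡ ps≡p)

-- Every entry of the prime factorisation of `n` equals `p`, so the exponent is the number of
-- factors; it is positive because the empty product is 1.
onlyPrimeDivisor⇒^ : 1 < n → (∀ {q} → Prime q → q ∣ n → q ≡ p) →
                     ∃[ k ] 1 ≤ k × n ≡ p ^ k
onlyPrimeDivisor⇒^ {n} {p} 1<n only = positive (length factors) (trans isFactorisation
  (product-≡ (All.tabulate λ q∈ → only (All.lookup factorsPrime q∈)
    (subst (_ ∣_) (sym isFactorisation) (∈⇒∣product q∈)))))
  where
  open PrimeFactorisation (factorise n {{>-nonZero (ℕ.<⇒≤ 1<n)}})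
  positive : ∀ k → n ≡ p ^ k → ∃[ k ] 1 ≤ k × n ≡ p ^ k
  positive zero    n≡1 = contradiction (sym n≡1) (ℕ.<⇒≢ 1<n)
  positive (suc k) n≡  = suc k , s≤s z≤n , n≡

∣⇒1<gcd : 1 < d → 0 < m → d ∣ m → d ∣ n → 1 < gcd m n
∣⇒1<gcd {m = m} {n} 1<d 0<m d∣m d∣n = ℕ.<-≤-trans 1<d
  (∣⇒≤ {{≢-nonZero (gcd[m,n]≢0 m n (inj₁ (ℕ.<⇒≢ 0<m ∘ sym)))}} (gcd-greatest d∣m d∣n))

-- A prime factor of the gcd divides `p ^ k`, so it is `p` itself.
1<gcd[p^k,n]⇒p∣n : ∀ k → Prime p → 1 < gcd (p ^ k) n → p ∣ n
1<gcd[p^k,n]⇒p∣n {p} {n} k pp 1<g =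
  let q , pq , q∣g = ∃prime∣ 1<g
      q≡p = prime∣prime^⇒≡ k pp pq (∣-trans q∣g (gcd[m,n]∣m (p ^ k) n))
  in subst (_∣ n) q≡p (∣-trans q∣g (gcd[m,n]∣n (p ^ k) n))

n<m^n : 1 < m → ∀ n → n < m ^ n
n<m^n     1<m zero    = s≤s z≤n
n<m^n {m} 1<m (suc n) = ℕ.≤-<-trans (n<m^n 1<m n)
  (subst (m ^ n <_) (ℕ.*-comm (m ^ n) m)
    (ℕ.m<m*n (m ^ n) m {{ℕ.m^n≢0 m n {{>-nonZero (ℕ.<⇒≤ 1<m)}}}} 1<m))

-- Search downwards from the bound; `P 0` ensures that the search succeeds.
boundedMaximum : {P : Pred ℕ 0ℓ} → Decidable P → P 0 → ∀ b → (∀ {j} → P j → j ≤ b) →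
                 ∃[ a ] IsMaximum P a
boundedMaximum P? P0 zero    bound = 0 , P0 , bound
boundedMaximum P? P0 (suc b) bound with P? (suc b)
... | yes Pb = suc b , Pb , bound
... | no ¬Pb = boundedMaximum P? P0 b λ Pj →
  s≤s⁻¹ (ℕ.≤∧≢⇒< (bound Pj) λ { refl → ¬Pb Pj })

-- Exponent 0 is admissible since `p ^ 0` computes to 1, and an admissible `j` satisfies
-- `j < p ^ j ≤ n`, so `n` bounds the search.
maximalExponent : 1 < p → 1 ≤ n → ∃[ a ] IsMaximum (λ j → p ^ j ≤ n) a
maximalExponent {p} {n} 1<p 1≤n = boundedMaximum (λ j → p ^ j ≤? n) 1≤n n
  λ {j} pʲ≤n → ℕ.≤-trans (ℕ.<⇒≤ (n<m^n 1<p j)) pʲ≤n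

-- Neighbourhoods and twins in G n

module _ {A : Set} (Γ : FiniteSimpleGraph A) where
  open FiniteSimpleGraph Γ

  -- The centre is adjacent to all its neighbours. The closed form is the one to apply to divisors
  -- of `v`, since `v` may be among them.
  simplicial⇒N[]-clique : ∀ {v} → v ∈ Simplicial → IsClique N[ v ]
  simplicial⇒N[]-clique s (inj₁ x∈N)       (inj₁ y∈N)       x≢y = s x∈N y∈N x≢y
  simplicial⇒N[]-clique s (inj₁ (_ , v~x)) (inj₂ refl)      x≢y = ~-sym v~x
  simplicial⇒N[]-clique s (inj₂ refl)      (inj₁ (_ , v~y)) x≢y = v~y
  simplicial⇒N[]-clique s (inj₂ refl)      (inj₂ refl)      x≢y = contradiction refl x≢y

module _ (n : ℕ) where
  open FiniteSimpleGraph (G n) using (V; N[_]; Simplicial; Tw; IsSimplicialTwinClass)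

  ∈V⁺ : 1 < v → v ≤ n → v ∈ V
  ∈V⁺ 1<v v≤n = Equivalence.from (∈V⇔ n) (1<v , v≤n)

  ∈V⇒1< : v ∈ V → 1 < v
  ∈V⇒1< = proj₁ ∘ Equivalence.to (∈V⇔ n)

  ∈V⇒≤ : v ∈ V → v ≤ n
  ∈V⇒≤ = proj₂ ∘ Equivalence.to (∈V⇔ n)

  ∈V⇒0< : v ∈ V → 0 < v
  ∈V⇒0< v∈V = ℕ.<⇒≤ (∈V⇒1< v∈V)

  divisor∈V : v ∈ V → 1 < d → d ∣ v → d ∈ V
  divisor∈V v∈V 1<d d∣v =
    ∈V⁺ 1<d (ℕ.≤-trans (∣⇒≤ {{>-nonZero (∈V⇒0< v∈V)}} d∣v) (∈V⇒≤ v∈V))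

  -- With `∈N[]⇒1<gcd` this turns membership in a closed neighbourhood into a gcd condition, so that
  -- later arguments avoid the case `x ≡ y`.
  ∈N[]⁺ : y ∈ V → 1 < gcd x y → y ∈ N[ x ]
  ∈N[]⁺ {y} {x} y∈V 1<g with x ℕ.≟ y
  ... | yes x≡y = inj₂ x≡y
  ... | no  x≢y = inj₁ (y∈V , x≢y , 1<g)

  ∈N[]⇒∈V : x ∈ V → y ∈ N[ x ] → y ∈ V
  ∈N[]⇒∈V x∈V (inj₁ (y∈V , _)) = y∈V
  ∈N[]⇒∈V x∈V (inj₂ refl)      = x∈V

  ∈N[]⇒1<gcd : x ∈ V → y ∈ N[ x ] → 1 < gcd x y
  ∈N[]⇒1<gcd x∈V (inj₁ (_ , _ , 1<g)) = 1<g
  ∈N[]⇒1<gcd x∈V (inj₂ refl) = ∣⇒1<gcd (∈V⇒1< x∈V) (∈V⇒0< x∈V) ∣-refl ∣-refl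

  divisor∈N[] : v ∈ V → 1 < d → d ∣ v → d ∈ N[ v ]
  divisor∈N[] v∈V 1<d d∣v =
    ∈N[]⁺ (divisor∈V v∈V 1<d d∣v) (∣⇒1<gcd 1<d (∈V⇒0< v∈V) d∣v ∣-refl)

  -- The right-hand side does not mention `k`: this is what makes all powers of `p` twins.
  N[p^k]≐multiples : Prime p → 1 ≤ k → p ^ k ∈ V → N[ p ^ k ] ≐ (λ u → u ∈ V × p ∣ u)
  N[p^k]≐multiples {p} {k} pp 1≤k pᵏ∈V =
      (λ u∈N → ∈N[]⇒∈V pᵏ∈V u∈N , 1<gcd[p^k,n]⇒p∣n k pp (∈N[]⇒1<gcd pᵏ∈V u∈N))
    , (λ (u∈V , p∣u) → ∈N[]⁺ u∈V (∣⇒1<gcd (prime⇒1< pp) (∈V⇒0< pᵏ∈V) (p∣p^k 1≤k) p∣u))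

  primePower⇒simplicial : v ∈ V → v ∈ IsPrimePower → v ∈ Simplicial
  primePower⇒simplicial v∈V (p , k , pp , 1≤k , refl) x∈N y∈N x≢y =
    let x∈V , p∣x = proj₁ (N[p^k]≐multiples pp 1≤k v∈V) (inj₁ x∈N)
        y∈V , p∣y = proj₁ (N[p^k]≐multiples pp 1≤k v∈V) (inj₁ y∈N)
    in x≢y , ∣⇒1<gcd (prime⇒1< pp) (∈V⇒0< x∈V) p∣x p∣y

  simplicial⇒primeDivisor-unique : v ∈ V → v ∈ Simplicial →
    Prime p → p ∣ v → Prime q → q ∣ v → q ≡ p
  simplicial⇒primeDivisor-unique {v} {p} {q} v∈V s pp p∣v pq q∣v with q ℕ.≟ p
  ... | yes q≡p = q≡p
  ... | no  q≢p =
    let _ , 1<g = simplicial⇒N[]-clique (G n) s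
          (divisor∈N[] v∈V (prime⇒1< pq) q∣v) (divisor∈N[] v∈V (prime⇒1< pp) p∣v) q≢p
        -- Distinct `q` and `p` would be adjacent, and a prime factor `r` of their gcd would equal
        -- both.
        r , pr , r∣g = ∃prime∣ 1<g
    in trans (sym (prime∣prime⇒≡ pq pr (∣-trans r∣g (gcd[m,n]∣m q p))))
             (prime∣prime⇒≡ pp pr (∣-trans r∣g (gcd[m,n]∣n q p)))

  simplicial⇒primePower : v ∈ V → v ∈ Simplicial → v ∈ IsPrimePower
  simplicial⇒primePower v∈V s =
    let p , pp , p∣v = ∃prime∣ (∈V⇒1< v∈V)
        k , 1≤k , v≡ = onlyPrimeDivisor⇒^ (∈V⇒1< v∈V)
                         (simplicial⇒primeDivisor-unique v∈V s pp p∣v)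
    in p , k , pp , 1≤k , v≡

  -- Powers of `p` share the neighbourhood of all multiples of `p`. Conversely, a prime divisor `q`
  -- of a twin `u` lies in `N[ u ]`, hence in `N[ p ^ k ]`, so `p ∣ q` and `q ≡ p`. The exponent `k`
  -- is arbitrary so that any simplicial vertex can represent its class.
  powers≐Tw : Prime p → IsMaximum (λ j → p ^ j ≤ n) a → 1 ≤ k → p ^ k ∈ V →
              powers p a ≐ Tw (p ^ k)
  powers≐Tw {p} {a} {k} pp (pᵃ≤n , max) 1≤k pᵏ∈V = ⇒ , ⇐
    where
    ⇒ : powers p a ⊆ Tw (p ^ k)
    ⇒ (j , 1≤j , j≤a , refl) = pʲ∈V ,
      ≐-trans (N[p^k]≐multiples pp 1≤j pʲ∈V) (≐-sym (N[p^k]≐multiples pp 1≤k pᵏ∈V))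
      where
      pʲ∈V : p ^ j ∈ V
      pʲ∈V = ∈V⁺
        (ℕ.≤-trans (prime⇒1< pp) (∣⇒≤ {{ℕ.m^n≢0 p j {{prime⇒nonZero pp}}}} (p∣p^k 1≤j)))
        (ℕ.≤-trans (ℕ.^-monoʳ-≤ p {{prime⇒nonZero pp}} j≤a) pᵃ≤n)

    ⇐ : Tw (p ^ k) ⊆ powers p a
    ⇐ {u} (u∈V , N[u]⊆ , _) =
      let j , 1≤j , u≡ = onlyPrimeDivisor⇒^ (∈V⇒1< u∈V) λ pq q∣u → sym (prime∣prime⇒≡ pq pp
            (proj₂ (proj₁ (N[p^k]≐multiples pp 1≤k pᵏ∈V)
              (N[u]⊆ (divisor∈N[] u∈V (prime⇒1< pq) q∣u)))))
      in j , 1≤j , max (subst (_≤ n) u≡ (∈V⇒≤ u∈V)) , u≡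

  powers≐Tw[p] : Prime p → IsMaximum (λ j → p ^ j ≤ n) a → p ≤ n → powers p a ≐ Tw p
  powers≐Tw[p] {p} {a} pp max p≤n = subst (λ x → powers p a ≐ Tw x) (ℕ.^-identityʳ p)
    (powers≐Tw pp max ℕ.≤-refl
      (subst (_∈ V) (sym (ℕ.^-identityʳ p)) (∈V⁺ (prime⇒1< pp) p≤n)))

  prime⇒isSimplicialTwinClass : Prime p → p ≤ n →
    ∃[ a ] IsMaximum (λ j → p ^ j ≤ n) a × IsSimplicialTwinClass (powers p a)
  prime⇒isSimplicialTwinClass {p} pp p≤n =
    let 1<p     = prime⇒1< pp
        p∈V     = ∈V⁺ 1<p p≤n
        a , max = maximalExponent 1<p (ℕ.≤-trans (ℕ.<⇒≤ 1<p) p≤n)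
    in a , max , p , p∈V
       , primePower⇒simplicial p∈V (p , 1 , pp , ℕ.≤-refl , sym (ℕ.^-identityʳ p))
       , powers≐Tw[p] pp max p≤n

  isSimplicialTwinClass⇒∃!prime : ∀ (S : Pred ℕ 0ℓ) → IsSimplicialTwinClass S →
    ∃! _≡_ λ p → Prime p × p ≤ n × ∃[ a ] (IsMaximum (λ j → p ^ j ≤ n) a × S ≐ powers p a)
  isSimplicialTwinClass⇒∃!prime S (v , v∈V , s , S≐) with simplicial⇒primePower v∈V s
  ... | p , k , pp , 1≤k , refl =
    let p≤n     = ∈V⇒≤ (divisor∈V v∈V (prime⇒1< pp) (p∣p^k 1≤k))
        a , max = maximalExponent (prime⇒1< pp) (ℕ.≤-trans (ℕ.<⇒≤ (prime⇒1< pp)) p≤n)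
        S≐p     = ≐-trans S≐ (≐-sym (powers≐Tw pp max 1≤k v∈V))
    in p , (pp , p≤n , a , max , S≐p) ,
       λ { {q} (pq , q≤n , b , (_ , maxq) , S≐q) →
         -- Maximality of `b` against the exponent 1 gives `1 ≤ b`, so `q` itself lies in `S`. It is
         -- then a power of `p`, which forces `q ≡ p`.
         let q¹≤n = subst (_≤ n) (sym (ℕ.^-identityʳ q)) q≤n
             j , _ , _ , q≡ = proj₁ S≐p
               (proj₂ S≐q (1 , ℕ.≤-refl , maxq q¹≤n , sym (ℕ.^-identityʳ q)))
         in sym (prime∣prime^⇒≡ j pp pq (subst (q ∣_) q≡ ∣-refl)) }

  twin-of-prime : Prime p → p ≤ n → u ∈ Tw p → ∃[ j ] 1 ≤ j × u ≡ p ^ j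
  twin-of-prime pp p≤n u∈ =
    let a , max = maximalExponent (prime⇒1< pp) (ℕ.≤-trans (ℕ.<⇒≤ (prime⇒1< pp)) p≤n)
        j , 1≤j , _ , u≡ = proj₂ (powers≐Tw[p] pp max p≤n) u∈
    in j , 1≤j , u≡

-- Finite sums of rationals

∑ : (A → ℚ) → List A → ℚ
∑ f xs = foldr ℚ._+_ 0ℚ (map f xs)

∑-cong : ∀ {f g : A → ℚ} xs → (∀ {x} → x ∈ₗ xs → f x ≡ g x) → ∑ f xs ≡ ∑ g xs
∑-cong []       f≡g = refl
∑-cong (x ∷ xs) f≡g = cong₂ ℚ._+_ (f≡g (here refl)) (∑-cong xs (f≡g ∘ there))

∑-zero : (xs : List A) → ∑ (λ _ → 0ℚ) xs ≡ 0ℚ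
∑-zero []       = refl
∑-zero (x ∷ xs) = trans (ℚ.+-identityˡ _) (∑-zero xs)

∑-+ : (f g : A → ℚ) → ∀ xs → ∑ (λ x → f x ℚ.+ g x) xs ≡ ∑ f xs ℚ.+ ∑ g xs
∑-+ f g []       = refl
∑-+ f g (x ∷ xs) = trans (cong (f x ℚ.+ g x ℚ.+_) (∑-+ f g xs)) (interchange (f x) (g x) (∑ f xs) (∑ g xs))

∑-swap : (f : A → B → ℚ) → ∀ xs ys →
         ∑ (λ x → ∑ (f x) ys) xs ≡ ∑ (λ y → ∑ (λ x → f x y) xs) ys
∑-swap f []       ys = sym (∑-zero ys)
∑-swap f (x ∷ xs) ys = trans (cong (∑ (f x) ys ℚ.+_) (∑-swap f xs ys)) (sym (∑-+ (f x) _ ys))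

∑-single : ∀ {f : A → ℚ} {x xs} → Unique xs → x ∈ₗ xs →
           (∀ {y} → y ∈ₗ xs → y ≢ x → f y ≡ 0ℚ) → ∑ f xs ≡ f x
∑-single {f = f} {x} {_ ∷ xs} (x∉ ∷ _) (here refl) off = begin
  f x ℚ.+ ∑ f xs          ≡⟨ cong (f x ℚ.+_) (∑-cong xs λ y∈ →
                               off (there y∈) (All.lookup x∉ y∈ ∘ sym)) ⟩
  f x ℚ.+ ∑ (λ _ → 0ℚ) xs ≡⟨ cong (f x ℚ.+_) (∑-zero xs) ⟩
  f x ℚ.+ 0ℚ              ≡⟨ ℚ.+-identityʳ _ ⟩
  f x                     ∎
  where open ≡-Reasoning
∑-single {f = f} {x} {y ∷ xs} (y∉ ∷ uniq) (there x∈) off = begin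
  f y ℚ.+ ∑ f xs ≡⟨ cong₂ ℚ._+_ (off (here refl) (All.lookup y∉ x∈)) (∑-single uniq x∈ (off ∘ there)) ⟩
  0ℚ ℚ.+ f x     ≡⟨ ℚ.+-identityˡ _ ⟩
  f x            ∎
  where open ≡-Reasoning

-- Writing a sum over a class as an indicator-weighted sum over a fixed list makes the order of
-- summation exchangeable.
∑-filter : ∀ {P : Pred A 0ℓ} (P? : Decidable P) (f : A → ℚ) xs →
           ∑ (λ x → if does (P? x) then f x else 0ℚ) xs ≡ ∑ f (filter P? xs)
∑-filter P? f []       = refl
∑-filter P? f (x ∷ xs) with does (P? x)
... | true  = cong (f x ℚ.+_) (∑-filter P? f xs)
... | false = trans (ℚ.+-identityˡ _) (∑-filter P? f xs)

-- Addition in `ℚ` normalises fractions, so the equation is checked on unnormalised representatives,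
-- where `toℚᵘ` is injective up to equivalence.
fromℚᵘ-homo-+ : ∀ p q → fromℚᵘ (p ℚᵘ.+ q) ≡ fromℚᵘ p ℚ.+ fromℚᵘ q
fromℚᵘ-homo-+ p q = ℚ.toℚᵘ-injective (ℚᵘ.≃-trans (ℚ.toℚᵘ-fromℚᵘ (p ℚᵘ.+ q))
  (ℚᵘ.≃-sym (ℚᵘ.≃-trans (ℚ.toℚᵘ-homo-+ (fromℚᵘ p) (fromℚᵘ q))
    (ℚᵘ.+-cong (ℚ.toℚᵘ-fromℚᵘ p) (ℚ.toℚᵘ-fromℚᵘ q)))))

fromℚᵘ-homo-* : ∀ p q → fromℚᵘ (p ℚᵘ.* q) ≡ fromℚᵘ p ℚ.* fromℚᵘ q
fromℚᵘ-homo-* p q = ℚ.toℚᵘ-injective (ℚᵘ.≃-trans (ℚ.toℚᵘ-fromℚᵘ (p ℚᵘ.* q))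
  (ℚᵘ.≃-sym (ℚᵘ.≃-trans (ℚ.toℚᵘ-homo-* (fromℚᵘ p) (fromℚᵘ q))
    (ℚᵘ.*-cong (ℚ.toℚᵘ-fromℚᵘ p) (ℚ.toℚᵘ-fromℚᵘ q)))))

suc-/1 : ∀ n → + suc n / 1 ≡ 1ℚ ℚ.+ + n / 1
suc-/1 n = trans (ℚ.fromℚᵘ-cong {mkℚᵘ (+ suc n) 0} {ℚᵘ.1ℚᵘ ℚᵘ.+ mkℚᵘ (+ n) 0}
    (*≡* (cong (λ i → (+ 1 ℤ.+ i) ℤ.* + 1) (sym (ℤ.*-identityʳ (+ n))))))
  (fromℚᵘ-homo-+ ℚᵘ.1ℚᵘ (mkℚᵘ (+ n) 0))

-- Total, with the default 0 at zero: the summand then carries no `NonZero` proof and is an ordinary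
-- function of the vertex.
reciprocal : ℕ → ℚ
reciprocal zero      = 0ℚ
reciprocal n@(suc _) = + 1 / n

1/n≡reciprocal : ∀ n .{{_ : NonZero n}} → + 1 / n ≡ reciprocal n
1/n≡reciprocal (suc n) = refl

n*reciprocal[n]≡1 : ∀ n .{{_ : NonZero n}} → (+ n / 1) ℚ.* reciprocal n ≡ 1ℚ
n*reciprocal[n]≡1 (suc k) = trans (sym (fromℚᵘ-homo-* (mkℚᵘ (+ suc k) 0) (mkℚᵘ (+ 1) k)))
  (ℚ.fromℚᵘ-cong (ℚᵘ.*-inverseʳ (mkℚᵘ (+ suc k) 0)))

∑-const : ∀ (xs : List A) r → ∑ (λ _ → r) xs ≡ (+ length xs / 1) ℚ.* r
∑-const []       r = sym (ℚ.*-zeroˡ r)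
∑-const (x ∷ xs) r = begin
  r ℚ.+ ∑ (λ _ → r) xs                   ≡⟨ cong₂ ℚ._+_ (sym (ℚ.*-identityˡ r)) (∑-const xs r) ⟩
  1ℚ ℚ.* r ℚ.+ (+ length xs / 1) ℚ.* r   ≡⟨ sym (ℚ.*-distribʳ-+ r 1ℚ (+ length xs / 1)) ⟩
  (1ℚ ℚ.+ + length xs / 1) ℚ.* r         ≡⟨ cong (ℚ._* r) (sym (suc-/1 (length xs))) ⟩
  (+ suc (length xs) / 1) ℚ.* r          ∎
  where open ≡-Reasoning

-- Double counting over the pairs `(p , v)` with `R p v`, each weighted by `reciprocal (c v)`.
-- Summing over `p` first leaves one term per `v`, as `v` lies in exactly one class; summing over
-- `v` first gives 1 for each class.
∑-reciprocal-classSize :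
  ∀ {R : B → Pred A 0ℓ} (R? : ∀ p → Decidable (R p)) {xs ps} (c : A → ℕ) →
  Unique ps →
  (∀ {v} → v ∈ₗ xs → ∃[ q ] q ∈ₗ ps × R q v × (∀ {p} → p ∈ₗ ps → R p v → p ≡ q)) →
  (∀ {p} → p ∈ₗ ps → NonZero (length (filter (R? p) xs))) →
  (∀ {p v} → p ∈ₗ ps → R p v → c v ≡ length (filter (R? p) xs)) →
  ∑ (λ v → reciprocal (c v)) xs ≡ + length ps / 1
∑-reciprocal-classSize {R = R} R? {xs} {ps} c uniq rep nonZero size = begin
  ∑ w xs                          ≡⟨ ∑-cong xs (λ v∈ → sym (column v∈)) ⟩
  ∑ (λ v → ∑ (λ p → f p v) ps) xs ≡⟨ ∑-swap (λ v p → f p v) xs ps ⟩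
  ∑ (λ p → ∑ (f p) xs) ps         ≡⟨ ∑-cong ps row ⟩
  ∑ (λ _ → 1ℚ) ps                 ≡⟨ ∑-const ps 1ℚ ⟩
  (+ length ps / 1) ℚ.* 1ℚ        ≡⟨ ℚ.*-identityʳ _ ⟩
  + length ps / 1                 ∎
  where
  open ≡-Reasoning
  w = λ v → reciprocal (c v)
  f = λ p v → if does (R? p v) then w v else 0ℚ

  -- Only the class of `q` contains `v`, so all other terms vanish.
  column : ∀ {v} → v ∈ₗ xs → ∑ (λ p → f p v) ps ≡ w v
  column {v} v∈ with rep v∈
  ... | q , q∈ , Rqv , unique = begin
    ∑ (λ p → f p v) ps ≡⟨ ∑-single uniq q∈ (λ p∈ p≢q →
                            cong (if_then w v else 0ℚ) (dec-false (R? _ v) (p≢q ∘ unique p∈))) ⟩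
    f q v              ≡⟨ cong (if_then w v else 0ℚ) (dec-true (R? q v) Rqv) ⟩
    w v                ∎

  -- A class of `k′` members contributes `k′` copies of `reciprocal k′`.
  row : ∀ {p} → p ∈ₗ ps → ∑ (f p) xs ≡ 1ℚ
  row {p} p∈ = begin
    ∑ (f p) xs                    ≡⟨ ∑-filter (R? p) w xs ⟩
    ∑ w ys                        ≡⟨ ∑-cong ys (λ v∈ → cong reciprocal
                                       (size p∈ (proj₂ (∈-filter⁻ (R? p) {xs = xs} v∈)))) ⟩
    ∑ (λ _ → reciprocal k′) ys    ≡⟨ ∑-const ys _ ⟩
    (+ k′ / 1) ℚ.* reciprocal k′  ≡⟨ n*reciprocal[n]≡1 k′ {{nonZero p∈}} ⟩
    1ℚ                            ∎
    where
    ys = filter (R? p) xs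
    k′ = length ys

-- Reconciles two counts of a class: `∣Tw∣` ranges over all vertices, the sum only over simplicial
-- ones.
filter-filter : ∀ {P Q : Pred A 0ℓ} (P? : Decidable P) (Q? : Decidable Q) → P ⊆ Q →
                ∀ xs → filter P? (filter Q? xs) ≡ filter P? xs
filter-filter P? Q? P⊆Q []       = refl
filter-filter P? Q? P⊆Q (x ∷ xs) with ih ← filter-filter P? Q? P⊆Q xs | P? x
... | yes Px rewrite filter-accept Q? {xs = xs} (P⊆Q Px) =
  trans (filter-accept P? Px) (cong (x ∷_) ih)
... | no ¬Px with does (Q? x)
...   | true  = trans (filter-reject P? ¬Px) ih
...   | false = ih

-- The sum formula for the prime-counting function

module _ (n : ℕ) where
  open FiniteSimpleGraph (G n)

  π≡∑-simplicial-1/∣Tw∣ : + π n / 1 ≡ ∑-simplicial-1/∣Tw∣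
  π≡∑-simplicial-1/∣Tw∣ = sym (begin
    ∑-simplicial-1/∣Tw∣
      -- The summand of `mapWith∈` depends on a membership proof; once it is expressed by
      -- `reciprocal`, the proof drops out and a plain `map` remains.
      ≡⟨ cong (foldr ℚ._+_ 0ℚ) (trans
           (mapWith∈-cong simplicialVertices _ _ λ v∈ →
             1/n≡reciprocal _ {{∣Tw∣-nonZero (proj₁ (∈-filter⁻ simplicial? v∈))}})
           (mapWith∈≗map _ simplicialVertices)) ⟩
    ∑ (λ v → reciprocal (∣Tw∣ v)) simplicialVertices
      ≡⟨ ∑-reciprocal-classSize Tw? ∣Tw∣ (Unique.filter⁺ prime? (Unique.upTo⁺ (suc n)))
           rep nonZero (λ p∈ v∈Tw → trans (∣Tw∣-cong v∈Tw) (sym (size p∈))) ⟩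
    + π n / 1 ∎)
    where
    open ≡-Reasoning
    primes = filter prime? (upTo (suc n))

    ∈primes⁻ : p ∈ₗ primes → Prime p × p ≤ n
    ∈primes⁻ p∈ = let p∈upTo , pp = ∈-filter⁻ prime? p∈ in pp , s≤s⁻¹ (∈-upTo⁻ p∈upTo)

    -- Being twins is transitive and symmetric, so twins have the same twin class.
    ∣Tw∣-cong : v ∈ Tw p → ∣Tw∣ v ≡ ∣Tw∣ p
    ∣Tw∣-cong {v} {p} (_ , N[v]≐N[p]) = cong length (filter-≐ (Tw? v) (Tw? p)
      ( (λ (u∈V , N[u]≐) → u∈V , ≐-trans N[u]≐ N[v]≐N[p])
      , (λ (u∈V , N[u]≐) → u∈V , ≐-trans N[u]≐ (≐-sym N[v]≐N[p]))) vertices)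

    -- Twins of a prime are prime powers, hence simplicial, so restricting to simplicial vertices
    -- loses none of them.
    size : p ∈ₗ primes → length (filter (Tw? p) simplicialVertices) ≡ ∣Tw∣ p
    size {p} p∈ = cong length (filter-filter (Tw? p) simplicial? (λ u∈Tw →
      let pp , p≤n     = ∈primes⁻ p∈
          j , 1≤j , u≡ = twin-of-prime n pp p≤n u∈Tw
      in primePower⇒simplicial n (proj₁ u∈Tw) (p , j , pp , 1≤j , u≡)) vertices)

    nonZero : p ∈ₗ primes → NonZero (length (filter (Tw? p) simplicialVertices))
    nonZero p∈ = let pp , p≤n = ∈primes⁻ p∈ in
      subst NonZero (sym (size p∈)) (∣Tw∣-nonZero (∈V⁺ n (prime⇒1< pp) p≤n))

    -- The representative is the base `q` of the prime power `v`. If `v` is also a twin of the prime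
    -- `p`, it is a power of `p`, so `p` divides a power of `q`.
    rep : v ∈ₗ simplicialVertices →
          ∃[ q ] q ∈ₗ primes × v ∈ Tw q × (∀ {p} → p ∈ₗ primes → v ∈ Tw p → p ≡ q)
    rep {v} v∈ with v∈V , s ← ∈-filter⁻ simplicial? v∈ | simplicial⇒primePower n v∈V s
    ... | q , k , pq , 1≤k , refl =
      let q≤n     = ∈V⇒≤ n (divisor∈V n v∈V (prime⇒1< pq) (p∣p^k 1≤k))
          a , max = maximalExponent (prime⇒1< pq) (ℕ.≤-trans (ℕ.<⇒≤ (prime⇒1< pq)) q≤n)
      in q , ∈-filter⁺ prime? (∈-upTo⁺ (s≤s q≤n)) pq
         , proj₁ (powers≐Tw[p] n pq max q≤n) (k , 1≤k , proj₂ max (∈V⇒≤ n v∈V) , refl)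
         , λ {p} p∈ v∈Tw →
             let pp , p≤n     = ∈primes⁻ p∈
                 j , 1≤j , v≡ = twin-of-prime n pp p≤n v∈Tw
             in prime∣prime^⇒≡ k pq pp (subst (p ∣_) (sym v≡) (p∣p^k 1≤j))

proposition18 : ∀ (n : ℕ) → 2 ≤ n →
    let open FiniteSimpleGraph (G n) in
    (∀ v → v ∈ V → (v ∈ Simplicial ⇔ v ∈ IsPrimePower))
    × (∀ p → Prime p → p ≤ n →
    ∃[ a ] IsMaximum (λ j → p ^ j ≤ n) a × IsSimplicialTwinClass (powers p a))
    × (∀ (S : Pred ℕ 0ℓ) → IsSimplicialTwinClass S →
    ∃! _≡_ λ p → Prime p × p ≤ n ×
    ∃[ a ] (IsMaximum (λ j → p ^ j ≤ n) a × S ≐ powers p a))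
    × (+ π n / 1 ≡ ∑-simplicial-1/∣Tw∣)
proposition18 n _ =
    (λ _ v∈V → mk⇔ (simplicial⇒primePower n v∈V) (primePower⇒simplicial n v∈V))
  , (λ _ → prime⇒isSimplicialTwinClass n)
  , isSimplicialTwinClass⇒∃!prime n
  , π≡∑-simplicial-1/∣Tw∣ n
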